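{- Let $a$ and $n$ be positive integers and let $S=\{x_1,\dots,x_n\}$ be a gcd closed set of $n$ distinct positive integers satisfying condition $\mathcal{G}$, with $\gcd(x_1,\dots,x_n)=1$ and indexed so that $x_1=1$. For each $i$ write $G_S(x_i)=\{y^i_1,\dots,y^i_{l_i}\}$ with $l_i=|G_S(x_i)|$. Let $B_S$ be the $n\times n$ matrix whose $(i,j)$-entry is $\mu_{x_j}\left(\frac{x_j}{x_i}\right)$ if $x_i\mid x_j$ and $0$ otherwise, and let $B_{S^a}$ be the $n\times n$ matrix whose $(i,j)$-entry is $\mu_{x_j}\left(\frac{x_j}{x_i}\right)\left(\frac{x_j}{x_i}\right)^a$ if $x_i\mid x_j$ and $0$ otherwise. Then $$B_S^T\big((x_i,x_j)^a\big)B_S=\operatorname{diag}\Big(1,\ (y^2_1,\dots,y^2_{l_2})^a\prod_{h=1}^{l_2}\Big(\Big(\frac{x_2}{y^2_h}\Big)^a-1\Big),\ \dots,\ (y^n_1,\dots,y^n_{l_n})^a\prod_{h=1}^{l_n}\Big(\Big(\frac{x_n}{y^n_h}\Big)^a-1\Big)\Big)$$ and $$B_{S^a}^T\big([x_i,x_j]^a\big)B_{S^a}=\operatorname{diag}\Big(1,\ x_2^a\prod_{h=1}^{l_2}\Big(1-\Big(\frac{x_2}{y^2_h}\Big)^a\Big),\ \dots,\ x_n^a\prod_{h=1}^{l_n}\Big(1-\Big(\frac{x_n}{y^n_h}\Big)^a\Big)\Big).$$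
   Context: $(x,y)$ (and $(y_1,\dots,y_k)$) denotes the greatest common divisor and $[x,y]$ the least common multiple; $((x_i,x_j)^a)$ and $([x_i,x_j]^a)$ denote the $n\times n$ matrices with $(i,j)$-entries $(x_i,x_j)^a$ and $[x_i,x_j]^a$. A set $S$ is gcd closed if $(x,y)\in S$ for all $x,y\in S$. For $x\in S$, an element $y\in S$ is a greatest-type divisor of $x$ in $S$ if $y\mid x$, $y<x$, and whenever $d\in S$ with $y\mid d\mid x$ then $d\in\{y,x\}$; $G_S(x)$ is the set of greatest-type divisors of $x$ in $S$. The set $S$ satisfies condition $\mathcal{G}$ if for every $x\in S$ with $|G_S(x)|\ge 2$ and any two distinct $y_1,y_2\in G_S(x)$ one has $[y_1,y_2]=x$ and $(y_1,y_2)\in G_S(y_1)\cap G_S(y_2)$. For $x\in S$ with $G_S(x)=\{y_1,\dots,y_k\}$, the imitative Möbius function $\mu_x$ on positive integers is defined by $\mu_x(1)=1$; $\mu_x(t)=(-1)^j$ if $t=\prod_{r=1}^{j}\frac{x}{y_{i_r}}$ for some $j\ge1$ distinct indices $i_1,\dots,i_j\in\{1,\dots,k\}$; and $\mu_x(t)=0$ otherwise. -}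

module Defs where

open import Data.Nat as ℕ using (ℕ; zero; suc; _<_)
open import Data.Nat.Divisibility using (_∣_; _∣?_)
open import Data.Nat.GCD using (gcd)
open import Data.Nat.LCM using (lcm)
open import Data.Nat.ListAction using (product)
open import Data.Nat.Properties using (_≟_; _<?_)
open import Data.Integer using (ℤ; +_; 0ℤ; 1ℤ; -1ℤ; _*_; _^_)
open import Data.Integer.Properties using (+-0-commutativeMonoid)
open import Data.Bool using (if_then_else_)
open import Data.Fin as Fin using (Fin)
open import Data.Fin.Subset using (Subset; Nonempty; ∣_∣)
open import Data.Fin.Subset.Properties using (_∈?_; nonempty?; anySubset?)
open import Data.List using (List; length; lookup; map; filter; foldr; allFin; tabulate)
open import Data.List.Membership.DecPropositional _≟_ using (_∈_) renaming (_∈?_ to _∈ₗ?_)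
open import Data.List.Relation.Unary.All using (All; all?)
open import Data.Product using (_×_; _,_)
open import Data.Sum using (_⊎_)
open import Data.Vec.Functional using (Vector)
open import Algebra.Properties.CommutativeMonoid.Sum +-0-commutativeMonoid using (sum)
open import Relation.Binary.PropositionalEquality using (_≡_; _≢_)
open import Relation.Nullary using (Dec; yes; no; does; _×-dec_; _⊎-dec_; _→-dec_)

-- Division made total by m ÷ 0 = 0, to avoid carrying NonZero instances.  It is
-- only ever applied to a positive divisor of the dividend.
infixl 7 _÷_
_÷_ : ℕ → ℕ → ℕ
m ÷ zero  = 0
m ÷ suc n = m ℕ./ suc n

gcds : List ℕ → ℕ
gcds = foldr gcd 0

-- Finite sets of numbers are given as lists of their elements.

GcdClosed : List ℕ → Set
GcdClosed S = ∀ {x y} → x ∈ S → y ∈ S → gcd x y ∈ S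

GreatestTypeDivisor : List ℕ → ℕ → ℕ → Set
GreatestTypeDivisor S x y =
  y ∈ S × y ∣ x × y < x × All (λ d → y ∣ d → d ∣ x → d ≡ y ⊎ d ≡ x) S

greatestTypeDivisor? : ∀ S x y → Dec (GreatestTypeDivisor S x y)
greatestTypeDivisor? S x y =
  (y ∈ₗ? S) ×-dec (y ∣? x) ×-dec (y <? x) ×-dec
  all? (λ d → (y ∣? d) →-dec ((d ∣? x) →-dec ((d ≟ y) ⊎-dec (d ≟ x)))) S

-- Repetition-free whenever S is, so its length is then |G_S(x)|.
G : List ℕ → ℕ → List ℕ
G S x = filter (greatestTypeDivisor? S x) S

ConditionG : List ℕ → Set
ConditionG S = ∀ {x} → x ∈ S → 2 ℕ.≤ length (G S x) →
  ∀ {y₁ y₂} → y₁ ∈ G S x → y₂ ∈ G S x → y₁ ≢ y₂ →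
  lcm y₁ y₂ ≡ x × gcd y₁ y₂ ∈ G S y₁ × gcd y₁ y₂ ∈ G S y₂

-- t is the product of the x / y_r, with r ranging over a nonempty set I of indices
-- into G_S(x) = {y_1, …, y_k}.
IsQuotientProduct : (S : List ℕ) (x t : ℕ) → Subset (length (G S x)) → Set
IsQuotientProduct S x t I =
  Nonempty I ×
  t ≡ product (map (λ r → x ÷ lookup (G S x) r) (filter (_∈? I) (allFin (length (G S x)))))

isQuotientProduct? : ∀ S x t I → Dec (IsQuotientProduct S x t I)
isQuotientProduct? S x t I = nonempty? I ×-dec (t ≟ _)

-- The sign depends on the set I found by the search.  For repetition-free S of
-- positive numbers satisfying condition G the quotients x / y_r are pairwise coprime
-- and greater than 1, so there t determines I, and t ≢ 1.
μ : List ℕ → ℕ → ℕ → ℤ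
μ S x t with t ≟ 1
... | yes _ = 1ℤ
... | no _ with anySubset? (isQuotientProduct? S x t)
...   | yes (I , _) = -1ℤ ^ ∣ I ∣
...   | no _        = 0ℤ

∏ : List ℕ → (ℕ → ℤ) → ℤ
∏ ys f = foldr _*_ 1ℤ (map f ys)

Matrix : ℕ → Set
Matrix n = Vector (Vector ℤ n) n

infixl 7 _·_
_·_ : ∀ {n} → Matrix n → Matrix n → Matrix n
(A · B) i j = sum (λ k → A i k * B k j)

diag : ∀ {n} → Vector ℤ n → Matrix n
diag d i j = if does (i Fin.≟ j) then d i else 0ℤ

infix 4 _≈ₘ_
_≈ₘ_ : ∀ {n} → Matrix n → Matrix n → Set
A ≈ₘ B = ∀ i j → A i j ≡ B i j

gcdPowerMatrix lcmPowerMatrix : ∀ {n} → ℕ → Vector ℕ n → Matrix n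
gcdPowerMatrix a x i j = + (gcd (x i) (x j) ℕ.^ a)
lcmPowerMatrix a x i j = + (lcm (x i) (x j) ℕ.^ a)

matrixB : ∀ {n} → Vector ℕ n → Matrix n
matrixB x i j =
  if does (x i ∣? x j) then μ (tabulate x) (x j) (x j ÷ x i) else 0ℤ

matrixBPow : ∀ {n} → ℕ → Vector ℕ n → Matrix n
matrixBPow a x i j =
  if does (x i ∣? x j)
  then μ (tabulate x) (x j) (x j ÷ x i) * + ((x j ÷ x i) ℕ.^ a)
  else 0ℤ

-- Write x = x j, G_S(x) = {y_1, …, y_k} and q_r = x / y_r.  Condition G makes the q_r pairwise
-- coprime, so x divided by the product of the q_r over a set I of indices is the gcd of the
-- corresponding y_r, hence lies in S.  Summing H against column j of B_S therefore gives the sum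
-- over all I of (-1)^|I| H(x / ∏_{r ∈ I} q_r).  For H = gcd(-, x k)^a with x ∤ x k, gcd(x, x k)
-- divides some y_r, and adding or removing that r leaves H unchanged, so the sum vanishes; the
-- same holds for lcm with B_{S^a}, as t · lcm(x / t, x k) = x · x k / gcd(x / t, x k).  If x = x k,
-- the sum factors as the product over G_S(x).
{-# OPTIONS --safe #-}
module Submission where

open import Defs
open import Data.Nat as ℕ using (ℕ; zero; suc; NonZero; _<_)
open import Data.Fin using (Fin; zero; suc)
open import Data.Integer using (ℤ; +_; 1ℤ; _*_; _-_)
open import Data.List using (tabulate)
open import Data.Product using (_×_)
open import Data.Vec.Functional using (Vector; transpose)
open import Function.Definitions using (Injective)
open import Relation.Binary.PropositionalEquality using (_≡_)
open import Data.Bool using (true; false; if_then_else_)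
open import Data.Fin as Fin using (punchIn)
open import Data.Fin.Properties using (punchInᵢ≢i)
open import Data.Fin.Subset using (Subset; ∣_∣; ⊥)
open import Data.Fin.Subset.Properties using (_∈?_; nonempty?; anySubset?; Empty-unique; ∣⊥∣≡0)
open import Data.Integer using (0ℤ; -1ℤ; _+_; _^_)
import Data.Integer.Properties as ℤ
import Data.Integer.Tactic.RingSolver as ℤ-Solver
open import Data.List using (List; foldr; map; filter; length; lookup; allFin)
open import Data.List.Membership.Propositional using (_∈_; find)
open import Data.List.Membership.Propositional.Properties using (∈-filter⁺; ∈-filter⁻; ∈-tabulate⁺; ∈-tabulate⁻)
open import Data.List.Properties using (map-tabulate)
open import Data.List.Relation.Unary.All as All using (All; all?)
open import Data.List.Relation.Unary.All.Properties using (¬All⇒Any¬)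
open import Data.List.Relation.Unary.AllPairs using (AllPairs)
open import Data.List.Relation.Unary.Any using (here; there)
import Data.List.Relation.Unary.Unique.Propositional.Properties as Unique
open import Data.Nat.Coprimality as Coprimality
  using (Coprime; coprime-divisor; coprime-factors; coprime⇒gcd≡1)
open import Data.Nat.Divisibility
open import Data.Nat.DivMod using (m*n/n≡m; m/n*n≡m)
open import Data.Nat.GCD
open import Data.Nat.Induction using (Acc; acc; <-wellFounded)
open import Data.Nat.LCM using (lcm; lcm-comm; lcm-least; n∣lcm[m,n]; gcd*lcm)
open import Data.Nat.ListAction using (product)
import Data.Nat.Properties as ℕ
open import Data.Nat.Properties using (_≟_)
import Data.Nat.Tactic.RingSolver as ℕ-Solver
open import Data.Product using (_,_; ∃-syntax; proj₁; proj₂)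
open import Data.Sum using (_⊎_; inj₁; inj₂)
open import Algebra.Properties.Semiring.Sum ℤ.+-*-semiring
  using (sum; sum-cong-≗; sum-remove; sum-replicate-zero; ∑-distrib-+; ∑-comm; *-distribˡ-sum; *-distribʳ-sum)
open import Function using (_∘_; id; _on_)
open import Relation.Binary.PropositionalEquality
  using (_≢_; refl; sym; trans; cong; cong₂; subst; module ≡-Reasoning)
open import Relation.Nullary.Decidable using (dec-true; dec-false)
open import Relation.Nullary
  using (Dec; yes; no; does; ¬_; contradiction; _→-dec_; _⊎-dec_)

module _ where

  open import Data.List using ([]; _∷_)
  open import Data.List.Relation.Unary.All using ([]; _∷_)
  open import Data.List.Relation.Unary.AllPairs using ([]; _∷_)
  open import Data.Vec using ([]; _∷_)

  private
    variable
      A : Set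
      n : ℕ

  -- Quotients, coprimality, gcd and lcm of natural numbers.

  ÷-cancelʳ : ∀ m {n} → 0 < n → m ℕ.* n ÷ n ≡ m
  ÷-cancelʳ m {suc n} _ = m*n/n≡m m (suc n)

  m÷n*n≡m : ∀ {m n} → 0 < n → n ∣ m → (m ÷ n) ℕ.* n ≡ m
  m÷n*n≡m {n = suc n} _ n∣m = m/n*n≡m n∣m

  ÷-unique : ∀ {m} o n → 0 < m → o ℕ.* n ≡ m → m ÷ n ≡ o
  ÷-unique o zero    0<m refl = contradiction (ℕ.*-zeroʳ o) (ℕ.m<n⇒n≢0 0<m)
  ÷-unique o (suc _) _   refl = ÷-cancelʳ o ℕ.z<s

  pos-^-* : ∀ m n a → + ((m ℕ.* n) ℕ.^ a) ≡ + (m ℕ.^ a) * + (n ℕ.^ a)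
  pos-^-* m n a = trans (cong +_ (^-distrib-* a)) (ℤ.pos-* (m ℕ.^ a) (n ℕ.^ a))
    where
    swap : ∀ b c d e → (b ℕ.* c) ℕ.* (d ℕ.* e) ≡ (b ℕ.* d) ℕ.* (c ℕ.* e)
    swap = ℕ-Solver.solve-∀
    ^-distrib-* : ∀ a → (m ℕ.* n) ℕ.^ a ≡ m ℕ.^ a ℕ.* n ℕ.^ a
    ^-distrib-* zero    = refl
    ^-distrib-* (suc a) = trans (cong (m ℕ.* n ℕ.*_) (^-distrib-* a)) (swap m n _ _)

  coprime-* : ∀ {m n o} → Coprime m n → Coprime m o → Coprime m (n ℕ.* o)
  coprime-* {n = n} c d (e∣m , e∣no) =
    d (e∣m , coprime-divisor (λ (f∣e , f∣n) → c (∣-trans f∣e e∣m , f∣n)) e∣no)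

  -- If `d` divides both quotients, then x / d is still a common multiple of `y` and `z`, so x = lcm
  -- y z divides x / d, and d = 1.
  lcm⇒coprime-quotients : ∀ {x y z p q} → 0 < x → lcm y z ≡ x →
    y ℕ.* p ≡ x → z ℕ.* q ≡ x → Coprime p q
  -- The patterns rebind `p` and `q` to the original quotients divided by `d`, so `y ℕ.* p` below is
  -- x / d.
  lcm⇒coprime-quotients {x} {y} {z} 0<x lcm≡x yp≡x zq≡x {d} (divides p refl , divides q refl) =
    ∣1⇒≡1 (*-cancelˡ-∣ (y ℕ.* p) (subst (_∣ y ℕ.* p ℕ.* 1) (sym ypd≡x) (subst (x ∣_) (sym (ℕ.*-identityʳ _)) x∣yp)))
    where
    ypd≡x = trans (ℕ.*-assoc y p d) yp≡x
    zqd≡x = trans (ℕ.*-assoc z q d) zq≡x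
    instance
      ypd≢0 : NonZero (y ℕ.* p ℕ.* d)
      ypd≢0 = ℕ.>-nonZero (subst (0 <_) (sym ypd≡x) 0<x)
      d≢0 : NonZero d
      d≢0 = ℕ.m*n≢0⇒n≢0 (y ℕ.* p)
      yp≢0 : NonZero (y ℕ.* p)
      yp≢0 = ℕ.m*n≢0⇒m≢0 (y ℕ.* p)
    yp≡zq : y ℕ.* p ≡ z ℕ.* q
    yp≡zq = ℕ.*-cancelʳ-≡ _ _ d (trans ypd≡x (sym zqd≡x))
    x∣yp : x ∣ y ℕ.* p
    x∣yp = subst (_∣ y ℕ.* p) lcm≡x (lcm-least {y} {z} (m∣m*n p) (subst (z ∣_) (sym yp≡zq) (m∣m*n q)))

  -- Since `q` divides z p and is coprime to `p`, z = w q for some `w`. Then y = w p, and the gcd is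
  -- w gcd(p, q) = w.
  gcd-cofactor : ∀ {x y z p q} → 0 < q → Coprime q p →
    y ℕ.* q ≡ x → z ℕ.* p ≡ x → gcd y z ℕ.* (q ℕ.* p) ≡ x
  gcd-cofactor {x} {y} {z} {p} {q} 0<q c yq≡x zp≡x
    with coprime-divisor c (subst (q ∣_) (trans (sym zp≡x) (ℕ.*-comm z p)) (subst (q ∣_) yq≡x (n∣m*n y)))
  ... | divides w refl = begin
    gcd y (w ℕ.* q) ℕ.* (q ℕ.* p)          ≡⟨ cong (λ v → gcd v (w ℕ.* q) ℕ.* (q ℕ.* p)) y≡wp ⟩
    gcd (w ℕ.* p) (w ℕ.* q) ℕ.* (q ℕ.* p)  ≡⟨ cong (ℕ._* (q ℕ.* p)) (c*gcd[m,n]≡gcd[cm,cn] w p q) ⟨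
    w ℕ.* gcd p q ℕ.* (q ℕ.* p)            ≡⟨ cong (λ g → w ℕ.* g ℕ.* (q ℕ.* p)) (coprime⇒gcd≡1 (Coprimality.sym c)) ⟩
    w ℕ.* 1 ℕ.* (q ℕ.* p)                  ≡⟨ rearrange w q p ⟩
    w ℕ.* q ℕ.* p                          ≡⟨ zp≡x ⟩
    x                                      ∎
    where
    open ≡-Reasoning
    instance
      q≢0 : NonZero q
      q≢0 = ℕ.>-nonZero 0<q
    rearrange : ∀ w q p → w ℕ.* 1 ℕ.* (q ℕ.* p) ≡ w ℕ.* q ℕ.* p
    rearrange = ℕ-Solver.solve-∀
    swap : ∀ w q p → w ℕ.* q ℕ.* p ≡ w ℕ.* p ℕ.* q
    swap = ℕ-Solver.solve-∀
    y≡wp : y ≡ w ℕ.* p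
    y≡wp = ℕ.*-cancelʳ-≡ _ _ q (trans yq≡x (trans (sym zp≡x) (swap w q p)))

  -- The gcd of w r and `k` divides gcd x k, hence y = s w. It also divides r w, and `r`, `s` are
  -- coprime, so it divides `w`.
  gcd-drop-factor : ∀ {x y w r s k} → 0 < r → Coprime r s →
    w ℕ.* (r ℕ.* s) ≡ x → y ℕ.* r ≡ x → gcd x k ∣ y → gcd w k ≡ gcd (w ℕ.* r) k
  gcd-drop-factor {x} {y} {w} {r} {s} {k} 0<r c wrs≡x yr≡x g∣y = ∣-antisym
    (gcd-greatest (∣-trans (gcd[m,n]∣m w k) (m∣m*n r)) (gcd[m,n]∣n w k))
    (gcd-greatest (coprime-factors c (subst (e ∣_) (ℕ.*-comm w r) (gcd[m,n]∣m (w ℕ.* r) k) , e∣sw))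
                  (gcd[m,n]∣n (w ℕ.* r) k))
    where
    e = gcd (w ℕ.* r) k
    instance
      r≢0 : NonZero r
      r≢0 = ℕ.>-nonZero 0<r
    swap : ∀ w r s → s ℕ.* w ℕ.* r ≡ w ℕ.* (r ℕ.* s)
    swap = ℕ-Solver.solve-∀
    y≡sw : y ≡ s ℕ.* w
    y≡sw = ℕ.*-cancelʳ-≡ _ _ r (trans yr≡x (trans (sym wrs≡x) (sym (swap w r s))))
    wr∣x : w ℕ.* r ∣ x
    wr∣x = divides s (trans (sym wrs≡x) (trans (sym (ℕ.*-assoc w r s)) (ℕ.*-comm (w ℕ.* r) s)))
    e∣sw : e ∣ s ℕ.* w
    e∣sw = subst (e ∣_) y≡sw (∣-trans (gcd-greatest (∣-trans (gcd[m,n]∣m (w ℕ.* r) k) wr∣x) (gcd[m,n]∣n (w ℕ.* r) k)) g∣y)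

  -- As long as w t stays fixed, the right side is constant, so t lcm(w, k) depends only on gcd(w,
  -- k). This reduces the lcm case to the gcd case.
  gcd*[m*lcm] : ∀ t w k → gcd w k ℕ.* (t ℕ.* lcm w k) ≡ w ℕ.* t ℕ.* k
  gcd*[m*lcm] t w k = begin
    gcd w k ℕ.* (t ℕ.* lcm w k)  ≡⟨ swap (gcd w k) t (lcm w k) ⟩
    t ℕ.* (gcd w k ℕ.* lcm w k)  ≡⟨ cong (t ℕ.*_) (gcd*lcm w k) ⟩
    t ℕ.* (w ℕ.* k)              ≡⟨ rearrange t w k ⟩
    w ℕ.* t ℕ.* k                ∎
    where
    open ≡-Reasoning
    swap : ∀ g t l → g ℕ.* (t ℕ.* l) ≡ t ℕ.* (g ℕ.* l)
    swap = ℕ-Solver.solve-∀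
    rearrange : ∀ t w k → t ℕ.* (w ℕ.* k) ≡ w ℕ.* t ℕ.* k
    rearrange = ℕ-Solver.solve-∀

  -- Sums with at most one nonzero term, and Iverson brackets.

  sum-only : ∀ (f : Vector ℤ n) j → (∀ k → k ≢ j → f k ≡ 0ℤ) → sum f ≡ f j
  sum-only {suc n} f j f≡0 = begin
    sum f                             ≡⟨ sum-remove {i = j} f ⟩
    f j + sum (λ k → f (punchIn j k)) ≡⟨ cong (_+_ (f j)) (sum-cong-≗ λ k → f≡0 (punchIn j k) (punchInᵢ≢i j k)) ⟩
    f j + sum {n} (λ _ → 0ℤ)          ≡⟨ cong (_+_ (f j)) (sum-replicate-zero n) ⟩
    f j + 0ℤ                          ≡⟨ ℤ.+-identityʳ (f j) ⟩
    f j                               ∎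
    where open ≡-Reasoning

  sum-zero : ∀ {f : Vector ℤ n} → (∀ k → f k ≡ 0ℤ) → sum f ≡ 0ℤ
  sum-zero {n} f≡0 = trans (sum-cong-≗ f≡0) (sum-replicate-zero n)

  ⟦_⟧ : ∀ {P : Set} → Dec P → ℤ
  ⟦ P? ⟧ = if does P? then 1ℤ else 0ℤ

  ⟦⟧-yes : ∀ {P : Set} (P? : Dec P) → P → ⟦ P? ⟧ ≡ 1ℤ
  ⟦⟧-yes P? p = cong (if_then 1ℤ else 0ℤ) (dec-true P? p)

  ⟦⟧-no : ∀ {P : Set} (P? : Dec P) → ¬ P → ⟦ P? ⟧ ≡ 0ℤ
  ⟦⟧-no P? ¬p = cong (if_then 1ℤ else 0ℤ) (dec-false P? ¬p)

  ⟦⟧-cong : ∀ {P Q : Set} (P? : Dec P) (Q? : Dec Q) → (P → Q) → (Q → P) → ⟦ P? ⟧ ≡ ⟦ Q? ⟧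
  ⟦⟧-cong (yes p) Q? f g = sym (⟦⟧-yes Q? (f p))
  ⟦⟧-cong (no ¬p) Q? f g = sym (⟦⟧-no Q? (¬p ∘ g))

  -- Alternating sums over subproducts

  -- A structurally recursive form of the filtered product in `IsQuotientProduct`, suited to
  -- induction on the list.
  subsetProduct : (q : A → ℕ) (ys : List A) → Subset (length ys) → ℕ
  subsetProduct q []       []          = 1
  subsetProduct q (y ∷ ys) (true  ∷ I) = q y ℕ.* subsetProduct q ys I
  subsetProduct q (y ∷ ys) (false ∷ I) = subsetProduct q ys I

  -- The sum of (-1)^|I| F (subsetProduct q ys I) over all subsets I.
  alternatingSum : (q : A → ℕ) → List A → (ℕ → ℤ) → ℤ
  alternatingSum q []       F = F 1
  alternatingSum q (y ∷ ys) F = alternatingSum q ys (λ t → F t + -1ℤ * F (q y ℕ.* t))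

  product-filter≡subsetProduct : ∀ (q : A → ℕ) ys (I : Subset (length ys)) →
    product (map (λ r → q (lookup ys r)) (filter (_∈? I) (allFin (length ys)))) ≡ subsetProduct q ys I
  product-filter≡subsetProduct q []       []      = refl
  product-filter≡subsetProduct q (y ∷ ys) (b ∷ I) = head b
    where
    f : Fin (length (y ∷ ys)) → ℕ
    f r = q (lookup (y ∷ ys) r)
    map-filter-suc : ∀ b is → map f (filter (_∈? (b ∷ I)) (map suc is)) ≡ map (f ∘ suc) (filter (_∈? I) is)
    map-filter-suc b []       = refl
    map-filter-suc b (i ∷ is) with does (i ∈? I)
    ... | true  = cong (_ ∷_) (map-filter-suc b is)
    ... | false = map-filter-suc b is
    tail : ∀ b → product (map f (filter (_∈? (b ∷ I)) (tabulate suc))) ≡ subsetProduct q ys I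
    tail b = begin
      product (map f (filter (_∈? (b ∷ I)) (tabulate suc)))                ≡⟨ cong (λ is → product (map f (filter (_∈? (b ∷ I)) is))) (map-tabulate id suc) ⟨
      product (map f (filter (_∈? (b ∷ I)) (map suc (allFin (length ys))))) ≡⟨ cong product (map-filter-suc b (allFin (length ys))) ⟩
      product (map (f ∘ suc) (filter (_∈? I) (allFin (length ys))))        ≡⟨ product-filter≡subsetProduct q ys I ⟩
      subsetProduct q ys I                                                 ∎
      where open ≡-Reasoning
    head : ∀ b → product (map f (filter (_∈? (b ∷ I)) (allFin (length (y ∷ ys))))) ≡ subsetProduct q (y ∷ ys) (b ∷ I)
    head true  = cong (q y ℕ.*_) (tail true)
    head false = tail false

  module _ {q : A → ℕ} where

    subsetProduct-⊥ : ∀ ys → subsetProduct q ys ⊥ ≡ 1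
    subsetProduct-⊥ []       = refl
    subsetProduct-⊥ (y ∷ ys) = subsetProduct-⊥ ys

    subsetProduct∣product : ∀ ys I → subsetProduct q ys I ∣ product (map q ys)
    subsetProduct∣product []       []          = ∣-refl
    subsetProduct∣product (y ∷ ys) (true  ∷ I) = *-monoʳ-∣ (q y) (subsetProduct∣product ys I)
    subsetProduct∣product (y ∷ ys) (false ∷ I) = ∣n⇒∣m*n (q y) (subsetProduct∣product ys I)

    coprime-subsetProduct : ∀ {m ys} → All (λ y → Coprime m (q y)) ys → ∀ I → Coprime m (subsetProduct q ys I)
    coprime-subsetProduct {m} []       []          = Coprimality.sym (Coprimality.1-coprimeTo m)
    coprime-subsetProduct     (c ∷ cs) (true  ∷ I) = coprime-* c (coprime-subsetProduct cs I)
    coprime-subsetProduct     (c ∷ cs) (false ∷ I) = coprime-subsetProduct cs I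

    -- Only values at subset products enter the sum. Asking for agreement there alone lets later
    -- proofs use facts about subset products, such as coprimality or the existence of a cofactor in
    -- the set.
    alternatingSum-cong : ∀ ys {F H : ℕ → ℤ} →
      (∀ I → F (subsetProduct q ys I) ≡ H (subsetProduct q ys I)) →
      alternatingSum q ys F ≡ alternatingSum q ys H
    alternatingSum-cong []       F≡H = F≡H []
    alternatingSum-cong (y ∷ ys) F≡H = alternatingSum-cong ys λ I →
      cong₂ (λ u v → u + -1ℤ * v) (F≡H (false ∷ I)) (F≡H (true ∷ I))

    alternatingSum-* : ∀ ys F c → alternatingSum q ys (λ t → F t * c) ≡ alternatingSum q ys F * c
    alternatingSum-* []       F c = refl
    alternatingSum-* (y ∷ ys) F c = trans
      (alternatingSum-cong ys λ I → factor (F _) (F _) c)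
      (alternatingSum-* ys (λ t → F t + -1ℤ * F (q y ℕ.* t)) c)
      where
      factor : ∀ u v c → u * c + -1ℤ * (v * c) ≡ (u + -1ℤ * v) * c
      factor = ℤ-Solver.solve-∀

    alternatingSum-zero : ∀ ys {F} → (∀ I → F (subsetProduct q ys I) ≡ 0ℤ) → alternatingSum q ys F ≡ 0ℤ
    alternatingSum-zero ys F≡0 = trans (alternatingSum-cong ys F≡0)
      -- The constant 0 is read as 0 * 0, so that a factor 0 can be pulled out of the sum.
      (trans (alternatingSum-* ys (λ _ → 0ℤ) 0ℤ) (ℤ.*-zeroʳ (alternatingSum q ys (λ _ → 0ℤ))))

    alternatingSum-sum : ∀ ys (F : Fin n → ℕ → ℤ) →
      sum (λ l → alternatingSum q ys (F l)) ≡ alternatingSum q ys (λ t → sum (λ l → F l t))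
    alternatingSum-sum []       F = refl
    alternatingSum-sum (y ∷ ys) F = trans
      (alternatingSum-sum ys (λ l t → F l t + -1ℤ * F l (q y ℕ.* t)))
      (alternatingSum-cong ys λ I → trans
        (∑-distrib-+ (λ l → F l _) (λ l → -1ℤ * F l _))
        (cong (_+_ (sum λ l → F l _)) (sym (*-distribˡ-sum -1ℤ (λ l → F l _)))))

    -- Pairwise coprime factors above 1 make the subset recoverable from its product: `q y` divides
    -- the product exactly when `y` was chosen. So at each `y` only one of the two terms survives,
    -- with sign -1 if `y` belongs to `I`.
    alternatingSum-indicator : ∀ {ys} → AllPairs (Coprime on q) ys → All (λ y → 1 < q y) ys → ∀ I →
      alternatingSum q ys (λ s → ⟦ s ≟ subsetProduct q ys I ⟧) ≡ -1ℤ ^ ∣ I ∣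
    alternatingSum-indicator [] [] [] = refl
    alternatingSum-indicator {y ∷ ys} (c ∷ cs) (1<q ∷ 1<qs) (true ∷ I) = begin
      alternatingSum q ys (λ s → ⟦ s ≟ q y ℕ.* P ⟧ + -1ℤ * ⟦ q y ℕ.* s ≟ q y ℕ.* P ⟧)
        ≡⟨ alternatingSum-cong ys (λ J → trans
             (cong₂ (λ u v → u + -1ℤ * v) (⟦⟧-no (_ ≟ _) (foreign J)) (cancel (subsetProduct q ys J)))
             (collect ⟦ subsetProduct q ys J ≟ P ⟧)) ⟩
      alternatingSum q ys (λ s → ⟦ s ≟ P ⟧ * -1ℤ)  ≡⟨ alternatingSum-* ys _ -1ℤ ⟩
      alternatingSum q ys (λ s → ⟦ s ≟ P ⟧) * -1ℤ  ≡⟨ cong (_* -1ℤ) (alternatingSum-indicator cs 1<qs I) ⟩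
      -1ℤ ^ ∣ I ∣ * -1ℤ                            ≡⟨ ℤ.*-comm (-1ℤ ^ ∣ I ∣) -1ℤ ⟩
      -1ℤ * -1ℤ ^ ∣ I ∣                            ∎
      where
      open ≡-Reasoning
      P = subsetProduct q ys I
      instance
        q≢0 : NonZero (q y)
        q≢0 = ℕ.>-nonZero (ℕ.<-trans ℕ.z<s 1<q)
      foreign : ∀ J → subsetProduct q ys J ≢ q y ℕ.* P
      foreign J eq = ℕ.<⇒≢ 1<q (sym (coprime-subsetProduct c J (∣-refl , subst (q y ∣_) (sym eq) (m∣m*n P))))
      cancel : ∀ s → ⟦ q y ℕ.* s ≟ q y ℕ.* P ⟧ ≡ ⟦ s ≟ P ⟧
      cancel s = ⟦⟧-cong (_ ≟ _) (_ ≟ _) (ℕ.*-cancelˡ-≡ s P (q y)) (cong (q y ℕ.*_))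
      collect : ∀ u → 0ℤ + -1ℤ * u ≡ u * -1ℤ
      collect = ℤ-Solver.solve-∀
    alternatingSum-indicator {y ∷ ys} (c ∷ cs) (1<q ∷ 1<qs) (false ∷ I) = trans
      (alternatingSum-cong ys λ J → trans
        (cong (λ u → ⟦ subsetProduct q ys J ≟ P ⟧ + -1ℤ * u) (⟦⟧-no (_ ≟ _) (foreign J)))
        (ℤ.+-identityʳ _))
      (alternatingSum-indicator cs 1<qs I)
      where
      P = subsetProduct q ys I
      foreign : ∀ J → q y ℕ.* subsetProduct q ys J ≢ P
      foreign J eq = ℕ.<⇒≢ 1<q (sym (coprime-subsetProduct c I (∣-refl , subst (q y ∣_) eq (m∣m*n _))))

    -- Adding or removing y pairs the subsets into cancelling terms.
    alternatingSum-vanishes : ∀ {ys y} {F : ℕ → ℤ} → AllPairs (Coprime on q) ys → y ∈ ys →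
      (∀ s → Coprime (q y) s → q y ℕ.* s ∣ product (map q ys) → F (q y ℕ.* s) ≡ F s) →
      alternatingSum q ys F ≡ 0ℤ
    alternatingSum-vanishes {y ∷ ys} {F = F} (c ∷ cs) (here refl) inv =
      alternatingSum-zero ys λ I → trans
        (cong (λ u → F _ + -1ℤ * u)
          (inv _ (coprime-subsetProduct c I) (*-monoʳ-∣ (q y) (subsetProduct∣product ys I))))
        (cancel (F _))
      where
      cancel : ∀ u → u + -1ℤ * u ≡ 0ℤ
      cancel = ℤ-Solver.solve-∀
    alternatingSum-vanishes {z ∷ ys} {y} {F} (c ∷ cs) (there y∈ys) inv =
      -- The function passed on combines `F` at `s` and at `q z ℕ.* s`. Both arguments are coprime
      -- to `q y`, the second because `q z` is, so `inv` applies to each.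
      alternatingSum-vanishes cs y∈ys λ s c′ d → cong₂ (λ u v → u + -1ℤ * v)
        (inv s c′ (∣n⇒∣m*n (q z) d))
        (trans (cong F (swap (q z) (q y) s))
               (inv (q z ℕ.* s) (coprime-* (Coprimality.sym (All.lookup c y∈ys)) c′)
                    (subst (_∣ product (map q (z ∷ ys))) (swap (q z) (q y) s) (*-monoʳ-∣ (q z) d))))
      where
      swap : ∀ a b s → a ℕ.* (b ℕ.* s) ≡ b ℕ.* (a ℕ.* s)
      swap = ℕ-Solver.solve-∀

    -- Here `u` is the complementary product. A factor `q y` contributes its power when `y` is left
    -- out, and -1 when `y` is taken. The constant `c` accumulates the factors already treated.
    alternatingSum-cofactor-^ : ∀ a c ys {F} →
      (∀ s u → u ℕ.* s ≡ product (map q ys) → F s ≡ c * + (u ℕ.^ a)) →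
      alternatingSum q ys F ≡ c * foldr _*_ 1ℤ (map (λ y → + (q y ℕ.^ a) - 1ℤ) ys)
    alternatingSum-cofactor-^ a c []       F≡ = trans (F≡ 1 1 refl) (cong (λ u → c * + u) (ℕ.^-zeroˡ a))
    alternatingSum-cofactor-^ a c (y ∷ ys) {F} F≡ = trans
      (alternatingSum-cofactor-^ a (c * (+ (q y ℕ.^ a) - 1ℤ)) ys λ s u us≡ → trans
        (cong₂ (λ v w → v + -1ℤ * w)
          (trans (F≡ s (q y ℕ.* u) (trans (ℕ.*-assoc (q y) u s) (cong (q y ℕ.*_) us≡)))
                 (cong (c *_) (pos-^-* (q y) u a)))
          (F≡ (q y ℕ.* s) u (trans (swap u (q y) s) (cong (q y ℕ.*_) us≡))))
        (factor c (+ (q y ℕ.^ a)) (+ (u ℕ.^ a))))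
      (ℤ.*-assoc c _ _)
      where
      swap : ∀ u b s → u ℕ.* (b ℕ.* s) ≡ b ℕ.* (u ℕ.* s)
      swap = ℕ-Solver.solve-∀
      factor : ∀ c r u → c * (r * u) + -1ℤ * (c * u) ≡ c * (r - 1ℤ) * u
      factor = ℤ-Solver.solve-∀

    -- The dual case: leaving `y` out contributes 1, taking it contributes minus the power of `q y`.
    alternatingSum-^ : ∀ a c ys {F} →
      (∀ s → s ∣ product (map q ys) → F s ≡ c * + (s ℕ.^ a)) →
      alternatingSum q ys F ≡ c * foldr _*_ 1ℤ (map (λ y → 1ℤ - + (q y ℕ.^ a)) ys)
    alternatingSum-^ a c []       F≡ = trans (F≡ 1 ∣-refl) (cong (λ u → c * + u) (ℕ.^-zeroˡ a))
    alternatingSum-^ a c (y ∷ ys) F≡ = trans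
      (alternatingSum-^ a (c * (1ℤ - + (q y ℕ.^ a))) ys λ s s∣ → trans
        (cong₂ (λ v w → v + -1ℤ * w)
          (F≡ s (∣n⇒∣m*n (q y) s∣))
          (trans (F≡ (q y ℕ.* s) (*-monoʳ-∣ (q y) s∣)) (cong (c *_) (pos-^-* (q y) s a))))
        (factor c (+ (q y ℕ.^ a)) (+ (s ℕ.^ a))))
      (ℤ.*-assoc c _ _)
      where
      factor : ∀ c r u → c * u + -1ℤ * (c * (r * u)) ≡ c * (1ℤ - r) * u
      factor = ℤ-Solver.solve-∀

  -- Gcds of several divisors of `x` and their cofactors.

  foldr-gcd-cofactor : ∀ (q : ℕ → ℕ) {x ys} → All (λ y → y ℕ.* q y ≡ x) ys → All (λ y → 1 < q y) ys →
    AllPairs (Coprime on q) ys → foldr gcd x ys ℕ.* product (map q ys) ≡ x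
  -- The fold starts from `x` rather than 0, so that the empty list matches the empty product.
  foldr-gcd-cofactor q {x} []         []           []       = ℕ.*-identityʳ x
  foldr-gcd-cofactor q {x} {y ∷ ys} (eq ∷ eqs) (1<q ∷ 1<qs) (c ∷ cs) =
    gcd-cofactor {y = y} {foldr gcd x ys} (ℕ.<-trans ℕ.z<s 1<q) (coprime-product c) eq (foldr-gcd-cofactor q eqs 1<qs cs)
    where
    coprime-product : ∀ {zs} → All (λ z → Coprime (q y) (q z)) zs → Coprime (q y) (product (map q zs))
    coprime-product []       = Coprimality.sym (Coprimality.1-coprimeTo (q y))
    coprime-product (c ∷ cs) = coprime-* c (coprime-product cs)

  -- The witness is the gcd of `x` and the chosen members of `ys`. It stays in `S` by gcd
  -- closedness, and `gcd-cofactor` identifies its cofactor one member at a time.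
  subsetProduct-cofactor : ∀ (q : ℕ → ℕ) {S x ys} → GcdClosed S → x ∈ S → All (_∈ S) ys →
    All (λ y → y ℕ.* q y ≡ x) ys → All (λ y → 1 < q y) ys → AllPairs (Coprime on q) ys →
    ∀ I → ∃[ w ] w ∈ S × w ℕ.* subsetProduct q ys I ≡ x
  subsetProduct-cofactor q {x = x} closed x∈S [] [] [] [] [] = x , x∈S , ℕ.*-identityʳ x
  subsetProduct-cofactor q closed x∈S (y∈S ∷ ys∈S) (eq ∷ eqs) (1<q ∷ 1<qs) (c ∷ cs) (b ∷ I)
    with subsetProduct-cofactor q closed x∈S ys∈S eqs 1<qs cs I
  subsetProduct-cofactor q {ys = y ∷ ys} closed x∈S (y∈S ∷ ys∈S) (eq ∷ eqs) (1<q ∷ 1<qs) (c ∷ cs) (true ∷ I)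
    | w , w∈S , wP≡x = gcd y w , closed y∈S w∈S ,
      gcd-cofactor {y = y} {w} (ℕ.<-trans ℕ.z<s 1<q) (coprime-subsetProduct c I) eq wP≡x
  subsetProduct-cofactor q closed x∈S (y∈S ∷ ys∈S) (eq ∷ eqs) (1<q ∷ 1<qs) (c ∷ cs) (false ∷ I)
    | w , w∈S , wP≡x = w , w∈S , wP≡x

  -- The innermost gcd returns the last element whether the seed is 0 or a multiple of that element.
  foldr-gcd-nonempty : ∀ {x} y ys → All (_∣ x) (y ∷ ys) → foldr gcd x (y ∷ ys) ≡ gcds (y ∷ ys)
  foldr-gcd-nonempty {x} y [] (y∣x ∷ []) = trans
    (∣-antisym (gcd[m,n]∣m y x) (gcd-greatest ∣-refl y∣x)) (sym (gcd-identityʳ y))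
  foldr-gcd-nonempty y (z ∷ ys) (_ ∷ d) = cong (gcd y) (foldr-gcd-nonempty z ys d)

  -- Greatest-type divisors

  -- If `d` is not itself of greatest type, some `e` in `S` lies strictly between `d` and `x` in the
  -- divisibility order. Replacing `d` by `e` shrinks `x ℕ.∸ d`, so the climb ends.
  ∃-greatestTypeDivisor : ∀ {S x d} → (∀ {y} → y ∈ S → 0 < y) → 0 < x → d ∈ S → d ∣ x → d ≢ x →
    ∃[ y ] y ∈ G S x × d ∣ y
  ∃-greatestTypeDivisor {S} {x} {d} S>0 0<x = climb d (<-wellFounded (x ℕ.∸ d))
    where
    instance
      x≢0 : NonZero x
      x≢0 = ℕ.>-nonZero 0<x
    maximal? : ∀ d e → Dec (d ∣ e → e ∣ x → e ≡ d ⊎ e ≡ x)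
    maximal? d e = (d ∣? e) →-dec ((e ∣? x) →-dec ((e ≟ d) ⊎-dec (e ≟ x)))
    climb : ∀ d → Acc _<_ (x ℕ.∸ d) → d ∈ S → d ∣ x → d ≢ x → ∃[ y ] y ∈ G S x × d ∣ y
    climb d (acc rec) d∈S d∣x d≢x with all? (maximal? d) S
    ... | yes max = d , ∈-filter⁺ (greatestTypeDivisor? S x) d∈S (d∈S , d∣x , ℕ.≤∧≢⇒< (∣⇒≤ d∣x) d≢x , max) , ∣-refl
    ... | no ¬max with find (¬All⇒Any¬ (maximal? d) S ¬max)
    -- Deciding the four atoms of the refuted implication extracts the strict intermediate `e`; the
    -- other cases contradict the refutation.
    ...   | e , e∈S , ¬e with d ∣? e | e ∣? x | e ≟ d | e ≟ x
    ...     | no d∤e  | _       | _      | _      = contradiction (λ d∣e → contradiction d∣e d∤e) ¬e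
    ...     | yes _   | no e∤x  | _      | _      = contradiction (λ _ e∣x → contradiction e∣x e∤x) ¬e
    ...     | yes _   | yes _   | yes eq | _      = contradiction (λ _ _ → inj₁ eq) ¬e
    ...     | yes _   | yes _   | no _   | yes eq = contradiction (λ _ _ → inj₂ eq) ¬e
    ...     | yes d∣e | yes e∣x | no e≢d | no e≢x =
      let y , y∈G , e∣y = climb e (rec (ℕ.∸-monoʳ-< d<e (∣⇒≤ e∣x))) e∈S e∣x e≢x
      in y , y∈G , ∣-trans d∣e e∣y
      where
      d<e : d < e
      d<e = ℕ.≤∧≢⇒< (∣⇒≤ {{ℕ.>-nonZero (S>0 e∈S)}} d∣e) (e≢d ∘ sym)

  allPairs-map-∈ : ∀ {P : A → A → Set} {Q : A → A → Set} {ys} →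
    (∀ {y z} → y ∈ ys → z ∈ ys → P y z → Q y z) → AllPairs P ys → AllPairs Q ys
  allPairs-map-∈ f []       = []
  allPairs-map-∈ f (p ∷ ps) =
    All.tabulate (λ z∈ys → f (here refl) (there z∈ys) (All.lookup p z∈ys))
    ∷ allPairs-map-∈ (λ y∈ z∈ → f (there y∈) (there z∈)) ps

  distinct⇒2≤length : ∀ {y z : A} {ys} → y ∈ ys → z ∈ ys → y ≢ z → 2 ℕ.≤ length ys
  distinct⇒2≤length {ys = _ ∷ []}    (here refl) (here refl) y≢z = contradiction refl y≢z
  distinct⇒2≤length {ys = _ ∷ _ ∷ _} _           _           _   = ℕ.s≤s (ℕ.s≤s ℕ.z≤n)

  -- By `alternatingSum-indicator` a set with product `t` determines the sum, so any set found by
  -- the search gives the right sign. The value at 1 comes from the empty set, and a `t` that is no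
  -- subset product makes every bracket 0.
  μ≡alternatingSum : ∀ {S x} → AllPairs (Coprime on (x ÷_)) (G S x) → All (λ y → 1 < x ÷ y) (G S x) → ∀ t →
    μ S x t ≡ alternatingSum (x ÷_) (G S x) (λ s → ⟦ s ≟ t ⟧)
  μ≡alternatingSum {S} {x} cs 1<qs t with t ≟ 1
  ... | yes refl = begin
    1ℤ                                                              ≡⟨ cong (-1ℤ ^_) (∣⊥∣≡0 (length (G S x))) ⟨
    -1ℤ ^ ∣ ⊥ {length (G S x)} ∣                                    ≡⟨ alternatingSum-indicator cs 1<qs ⊥ ⟨
    alternatingSum (x ÷_) (G S x) (λ s → ⟦ s ≟ subsetProduct (x ÷_) (G S x) ⊥ ⟧)
      ≡⟨ cong (λ p → alternatingSum (x ÷_) (G S x) (λ s → ⟦ s ≟ p ⟧)) (subsetProduct-⊥ (G S x)) ⟩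
    alternatingSum (x ÷_) (G S x) (λ s → ⟦ s ≟ 1 ⟧)                 ∎
    where open ≡-Reasoning
  ... | no t≢1 with anySubset? (isQuotientProduct? S x t)
  ...   | yes (I , _ , t≡) = trans (sym (alternatingSum-indicator cs 1<qs I))
    (cong (λ p → alternatingSum (x ÷_) (G S x) (λ s → ⟦ s ≟ p ⟧))
      (sym (trans t≡ (product-filter≡subsetProduct (x ÷_) (G S x) I))))
  ...   | no ¬∃ = sym (alternatingSum-zero (G S x) λ I → ⟦⟧-no (_ ≟ _) (foreign I))
    where
    foreign : ∀ I → subsetProduct (x ÷_) (G S x) I ≢ t
    foreign I eq with nonempty? I
    ... | yes I≢∅ = ¬∃ (I , I≢∅ , trans (sym eq) (sym (product-filter≡subsetProduct (x ÷_) (G S x) I)))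
    ... | no I≡∅ = t≢1 (trans (sym eq)
      (trans (cong (subsetProduct (x ÷_) (G S x)) (Empty-unique I≡∅)) (subsetProduct-⊥ (G S x))))

  -- Vanishing of (Bᵀ A) i k for x i ∤ x k makes the product triangular for divisibility, and
  -- the symmetry of A then makes it diagonal.
  congruence-diagonal : ∀ {x : Vector ℕ n} → Injective _≡_ _≡_ x → (A B : Matrix n) (d : Vector ℤ n) →
    (∀ k l → A k l ≡ A l k) →
    (∀ k j → ¬ x k ∣ x j → B k j ≡ 0ℤ) → (∀ j → B j j ≡ 1ℤ) →
    (∀ i k → ¬ x i ∣ x k → (transpose B · A) i k ≡ 0ℤ) → (∀ i → (transpose B · A) i i ≡ d i) →
    transpose B · A · B ≈ₘ diag d
  congruence-diagonal {n} {x} inj A B d A-sym B-support B-one vanish diagonal i j = entry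
    where
    C M : Matrix n
    C = transpose B · A
    M = C · B
    entry-zero : ∀ i j → ¬ x i ∣ x j → M i j ≡ 0ℤ
    entry-zero i j i∤j = sum-zero term
      where
      term : ∀ k → C i k * B k j ≡ 0ℤ
      -- If neither factor were forced to vanish, `x i` would divide `x k` and `x k` would divide
      -- `x j`, against the assumption.
      term k with x i ∣? x k
      ... | no i∤k  = trans (cong (_* B k j) (vanish i k i∤k)) (ℤ.*-zeroˡ (B k j))
      ... | yes i∣k = trans (cong (C i k *_) (B-support k j (i∤j ∘ ∣-trans i∣k))) (ℤ.*-zeroʳ (C i k))
    entry-sym : ∀ i j → M i j ≡ M j i
    entry-sym i j = begin
      sum (λ k → C i k * B k j)                          ≡⟨ sum-cong-≗ (λ k → *-distribʳ-sum (B k j) (λ l → B l i * A l k)) ⟩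
      sum (λ k → sum (λ l → B l i * A l k * B k j))      ≡⟨ ∑-comm (λ k l → B l i * A l k * B k j) ⟩
      sum (λ l → sum (λ k → B l i * A l k * B k j))      ≡⟨ sum-cong-≗ (λ l → sum-cong-≗ (λ k → trans (swap (B l i) (A l k) (B k j)) (cong (λ u → B k j * u * B l i) (A-sym l k)))) ⟩
      sum (λ l → sum (λ k → B k j * A k l * B l i))      ≡⟨ sum-cong-≗ (λ l → *-distribʳ-sum (B l i) (λ k → B k j * A k l)) ⟨
      sum (λ l → C j l * B l i)                          ∎
      where
      open ≡-Reasoning
      swap : ∀ u v w → u * v * w ≡ w * v * u
      swap = ℤ-Solver.solve-∀
    entry-diagonal : ∀ i → M i i ≡ d i
    entry-diagonal i = begin
      M i i            ≡⟨ sum-only (λ k → C i k * B k i) i term ⟩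
      C i i * B i i    ≡⟨ cong₂ _*_ (diagonal i) (B-one i) ⟩
      d i * 1ℤ         ≡⟨ ℤ.*-identityʳ (d i) ⟩
      d i              ∎
      where
      open ≡-Reasoning
      term : ∀ k → k ≢ i → C i k * B k i ≡ 0ℤ
      term k k≢i with x i ∣? x k
      ... | no i∤k  = trans (cong (_* B k i) (vanish i k i∤k)) (ℤ.*-zeroˡ (B k i))
      -- Mutual divisibility would give x k = x i, against injectivity.
      ... | yes i∣k = trans
        (cong (C i k *_) (B-support k i (λ k∣i → k≢i (inj (∣-antisym k∣i i∣k)))))
        (ℤ.*-zeroʳ (C i k))
    entry : M i j ≡ diag d i j
    entry with i Fin.≟ j
    ... | yes refl = entry-diagonal i
    ... | no i≢j with x i ∣? x j
    ...   | no i∤j  = entry-zero i j i∤j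
    ...   | yes i∣j = trans (entry-sym i j) (entry-zero j i (λ j∣i → i≢j (inj (∣-antisym i∣j j∣i))))

  -- Columns of the matrix B over a gcd closed set with condition G.

  module GcdClosedSet {n} (x : Vector ℕ n) (x>0 : ∀ i → 0 < x i) (inj : Injective _≡_ _≡_ x)
    (closed : GcdClosed (tabulate x)) (condG : ConditionG (tabulate x)) where

    S : List ℕ
    S = tabulate x

    x∈S : ∀ i → x i ∈ S
    x∈S i = ∈-tabulate⁺ i

    S>0 : ∀ {y} → y ∈ S → 0 < y
    S>0 y∈S with ∈-tabulate⁻ y∈S
    ... | i , refl = x>0 i

    module _ (j : Fin n) where

      ys : List ℕ
      ys = G S (x j)

      q : ℕ → ℕ
      q y = x j ÷ y

      ys⇒ : ∀ {y} → y ∈ ys → GreatestTypeDivisor S (x j) y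
      ys⇒ = proj₂ ∘ ∈-filter⁻ (greatestTypeDivisor? S (x j)) {xs = S}

      ys⊆S : All (_∈ S) ys
      ys⊆S = All.tabulate (proj₁ ∘ ys⇒)

      y*q≡x : All (λ y → y ℕ.* q y ≡ x j) ys
      y*q≡x = All.tabulate λ {y} y∈ys → let y∈S , y∣x , _ = ys⇒ y∈ys in
        trans (ℕ.*-comm y (q y)) (m÷n*n≡m (S>0 y∈S) y∣x)

      1<q : All (λ y → 1 < q y) ys
      1<q = All.tabulate λ {y} y∈ys → let _ , _ , y<x , _ = ys⇒ y∈ys in
        ℕ.*-cancelˡ-< y 1 (q y) (ℕ.<-≤-trans (subst (_< x j) (sym (ℕ.*-identityʳ y)) y<x)
          (ℕ.≤-reflexive (sym (All.lookup y*q≡x y∈ys))))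

      -- Two distinct members of `ys` trigger condition G, which makes `x j` their lcm;
      -- `lcm⇒coprime-quotients` then applies.
      q-coprime : AllPairs (Coprime on q) ys
      q-coprime = allPairs-map-∈
        (λ {y} {z} y∈ z∈ y≢z → lcm⇒coprime-quotients {y = y} {z}
          (x>0 j) (proj₁ (condG (x∈S j) (distinct⇒2≤length y∈ z∈ y≢z) y∈ z∈ y≢z))
          (All.lookup y*q≡x y∈) (All.lookup y*q≡x z∈))
        (Unique.filter⁺ (greatestTypeDivisor? S (x j)) (Unique.tabulate⁺ inj))

      foldr-gcd*product≡x : foldr gcd (x j) ys ℕ.* product (map q ys) ≡ x j
      foldr-gcd*product≡x = foldr-gcd-cofactor q y*q≡x 1<q q-coprime

      ∣product⇒∣x : ∀ {s} → s ∣ product (map q ys) → s ∣ x j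
      ∣product⇒∣x s∣ = ∣-trans s∣ (divides (foldr gcd (x j) ys) (sym foldr-gcd*product≡x))

      -- Testing `x l ℕ.* s ≟ x j` instead of comparing `s` with the quotient absorbs the
      -- divisibility test of `matrixB`: if `x l` does not divide `x j`, every bracket is 0.
      matrixB≡alternatingSum : ∀ l → matrixB x l j ≡ alternatingSum q ys (λ s → ⟦ x l ℕ.* s ≟ x j ⟧)
      matrixB≡alternatingSum l with x l ∣? x j
      ... | yes l∣j = trans (μ≡alternatingSum q-coprime 1<q (x j ÷ x l))
        (alternatingSum-cong ys λ I → ⟦⟧-cong (subsetProduct q ys I ≟ x j ÷ x l) (x l ℕ.* subsetProduct q ys I ≟ x j)
          (λ eq → trans (cong (x l ℕ.*_) eq) (trans (ℕ.*-comm (x l) (x j ÷ x l)) (m÷n*n≡m (x>0 l) l∣j)))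
          (λ eq → sym (÷-unique (subsetProduct q ys I) (x l) (x>0 j) (trans (ℕ.*-comm _ (x l)) eq))))
      ... | no l∤j = sym (alternatingSum-zero ys λ I →
        ⟦⟧-no (_ ≟ _) (λ eq → l∤j (subst (x l ∣_) eq (m∣m*n _))))

      -- After exchanging the sums, each subset product `s` selects exactly one row `l` with x l * s
      -- = x j. It exists by `subsetProduct-cofactor` and is unique by injectivity.
      columnSum : ∀ (H : Fin n → ℤ) F → (∀ l t → x l ℕ.* t ≡ x j → H l ≡ F t) →
        sum (λ l → matrixB x l j * H l) ≡ alternatingSum q ys F
      columnSum H F H≡F = begin
        sum (λ l → matrixB x l j * H l)
          ≡⟨ sum-cong-≗ (λ l → trans (cong (_* H l) (matrixB≡alternatingSum l))
               (sym (alternatingSum-* ys (λ s → ⟦ x l ℕ.* s ≟ x j ⟧) (H l)))) ⟩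
        sum (λ l → alternatingSum q ys (λ s → ⟦ x l ℕ.* s ≟ x j ⟧ * H l))
          ≡⟨ alternatingSum-sum ys (λ l s → ⟦ x l ℕ.* s ≟ x j ⟧ * H l) ⟩
        alternatingSum q ys (λ s → sum (λ l → ⟦ x l ℕ.* s ≟ x j ⟧ * H l))
          ≡⟨ alternatingSum-cong ys pick ⟩
        alternatingSum q ys F
          ∎
        where
        open ≡-Reasoning
        pick : ∀ I → let s = subsetProduct q ys I in sum (λ l → ⟦ x l ℕ.* s ≟ x j ⟧ * H l) ≡ F s
        pick I with subsetProduct-cofactor q closed (x∈S j) ys⊆S y*q≡x 1<q q-coprime I
        ... | w , w∈S , ws≡x with ∈-tabulate⁻ w∈S
        ...   | k , refl = begin
          sum (λ l → ⟦ x l ℕ.* s ≟ x j ⟧ * H l)  ≡⟨ sum-only _ k others ⟩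
          ⟦ x k ℕ.* s ≟ x j ⟧ * H k              ≡⟨ cong₂ _*_ (⟦⟧-yes (_ ≟ _) ws≡x) (H≡F k s ws≡x) ⟩
          1ℤ * F s                               ≡⟨ ℤ.*-identityˡ (F s) ⟩
          F s                                    ∎
          where
          s = subsetProduct q ys I
          instance
            s≢0 : NonZero s
            s≢0 = ℕ.m*n≢0⇒n≢0 (x k) {{ℕ.>-nonZero (subst (0 <_) (sym ws≡x) (x>0 j))}}
          others : ∀ l → l ≢ k → ⟦ x l ℕ.* s ≟ x j ⟧ * H l ≡ 0ℤ
          others l l≢k = trans
            (cong (_* H l) (⟦⟧-no (_ ≟ _) λ eq → l≢k (inj (ℕ.*-cancelʳ-≡ (x l) (x k) s (trans eq (sym ws≡x))))))
            (ℤ.*-zeroˡ (H l))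

      -- If x j ∤ x k then gcd (x j) (x k) divides some y ∈ ys, whose quotient can be
      -- inserted without affecting the gcd with x k.
      columnSum-vanishes : ∀ {k} {F : ℕ → ℤ} → ¬ x j ∣ x k →
        (∀ r s w → w ℕ.* (r ℕ.* s) ≡ x j → gcd w (x k) ≡ gcd (w ℕ.* r) (x k) → F (r ℕ.* s) ≡ F s) →
        alternatingSum q ys F ≡ 0ℤ
      columnSum-vanishes {k} j∤k F-inv =
        let g = gcd (x j) (x k)
            y , y∈ys , g∣y = ∃-greatestTypeDivisor {d = g} S>0 (x>0 j) (closed (x∈S j) (x∈S k)) (gcd[m,n]∣m (x j) (x k))
              (λ g≡x → j∤k (subst (_∣ x k) g≡x (gcd[m,n]∣n (x j) (x k))))
        -- The number `w` is x j / (q y * s), available because the product of all quotients divides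
        -- `x j`.
        in alternatingSum-vanishes q-coprime y∈ys λ s c rs∣ → let w = quotient (∣product⇒∣x rs∣) in
           let wrs≡x = sym (m∣n⇒n≡quotient*m (∣product⇒∣x rs∣)) in
           F-inv (q y) s w wrs≡x
             (gcd-drop-factor {y = y} {w} (ℕ.<-trans ℕ.z<s (All.lookup 1<q y∈ys)) c wrs≡x (All.lookup y*q≡x y∈ys) g∣y)

      matrixB-one : matrixB x j j ≡ 1ℤ
      matrixB-one with x j ∣? x j
      ... | yes _ = cong (μ S (x j)) (÷-unique 1 (x j) (x>0 j) (ℕ.*-identityˡ (x j)))
      ... | no ∤  = contradiction ∣-refl ∤

    matrixB-support : ∀ k j → ¬ x k ∣ x j → matrixB x k j ≡ 0ℤ
    matrixB-support k j k∤j with x k ∣? x j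
    ... | yes k∣j = contradiction k∣j k∤j
    ... | no _    = refl

    -- The gcd and lcm power matrices and their diagonal forms.

    module _ (a : ℕ) where

      matrixBPow≡matrixB* : ∀ k j → matrixBPow a x k j ≡ matrixB x k j * + ((x j ÷ x k) ℕ.^ a)
      matrixBPow≡matrixB* k j with x k ∣? x j
      ... | yes _ = refl
      ... | no _  = sym (ℤ.*-zeroˡ (+ ((x j ÷ x k) ℕ.^ a)))

      gcdSum : ∀ i k → (transpose (matrixB x) · gcdPowerMatrix a x) i k
        ≡ alternatingSum (q i) (ys i) (λ t → + (gcd (x i ÷ t) (x k) ℕ.^ a))
      gcdSum i k = columnSum i _ _ λ l t eq → cong (λ w → + (gcd w (x k) ℕ.^ a)) (sym (÷-unique (x l) t (x>0 i) eq))

      -- The weight in `matrixBPow` merges with the lcm into a single power of t lcm(x i / t, x k),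
      -- the expression handled by `gcd*[m*lcm]`.
      lcmSum : ∀ i k → (transpose (matrixBPow a x) · lcmPowerMatrix a x) i k
        ≡ alternatingSum (q i) (ys i) (λ t → + ((t ℕ.* lcm (x i ÷ t) (x k)) ℕ.^ a))
      lcmSum i k = trans
        (sum-cong-≗ λ l → trans (cong (_* + (lcm (x l) (x k) ℕ.^ a)) (matrixBPow≡matrixB* l i))
          (ℤ.*-assoc (matrixB x l i) _ _))
        (columnSum i (λ l → + ((x i ÷ x l) ℕ.^ a) * + (lcm (x l) (x k) ℕ.^ a)) _ λ l t eq → trans
          (sym (pos-^-* (x i ÷ x l) (lcm (x l) (x k)) a))
          (cong₂ (λ u w → + ((u ℕ.* lcm w (x k)) ℕ.^ a))
            (÷-unique t (x l) (x>0 i) (trans (ℕ.*-comm t (x l)) eq)) (sym (÷-unique (x l) t (x>0 i) eq))))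

      -- foldr gcd (x i) agrees with gcds unless ys i is empty, where gcds [] = 0.
      gcdEntry lcmEntry : Vector ℤ n
      gcdEntry i = + (foldr gcd (x i) (ys i) ℕ.^ a) * ∏ (ys i) (λ y → + ((x i ÷ y) ℕ.^ a) - 1ℤ)
      lcmEntry i = + (x i ℕ.^ a) * ∏ (ys i) (λ y → 1ℤ - + ((x i ÷ y) ℕ.^ a))

      gcd-diagonal : transpose (matrixB x) · gcdPowerMatrix a x · matrixB x
        ≈ₘ diag gcdEntry
      gcd-diagonal = congruence-diagonal inj (gcdPowerMatrix a x) (matrixB x) _
        (λ k l → cong (λ g → + (g ℕ.^ a)) (gcd-comm (x k) (x l)))
        matrixB-support matrixB-one
        -- The quotients of `x i` by r s and by `s` are `w` and w r, so the invariance is exactly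
        -- `g≡`.
        (λ i k i∤k → trans (gcdSum i k) (columnSum-vanishes i i∤k λ r s w wrs≡x g≡ →
          cong (λ g → + (g ℕ.^ a)) (trans
            (cong (λ v → gcd v (x k)) (÷-unique w (r ℕ.* s) (x>0 i) wrs≡x))
            (trans g≡ (cong (λ v → gcd v (x k))
              (sym (÷-unique (w ℕ.* r) s (x>0 i) (trans (ℕ.*-assoc w r s) wrs≡x))))))))
        -- With `u` complementary to `s`, the quotient of `x i` by `s` is g u. It divides `x i`, so
        -- the gcd is g u itself.
        (λ i → trans (gcdSum i i) (alternatingSum-cofactor-^ a (+ (foldr gcd (x i) (ys i) ℕ.^ a)) (ys i) λ s u us≡ →
          let g = foldr gcd (x i) (ys i)
              gus≡x = trans (ℕ.*-assoc g u s) (trans (cong (g ℕ.*_) us≡) (foldr-gcd*product≡x i))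
          in trans
            (cong (λ v → + (v ℕ.^ a)) (trans
              (cong (λ v → gcd v (x i)) (÷-unique (g ℕ.* u) s (x>0 i) gus≡x))
              (∣-antisym (gcd[m,n]∣m (g ℕ.* u) (x i)) (gcd-greatest ∣-refl (subst (g ℕ.* u ∣_) gus≡x (m∣m*n s))))))
            (pos-^-* g u a)))

      lcm-diagonal : transpose (matrixBPow a x) · lcmPowerMatrix a x · matrixBPow a x
        ≈ₘ diag lcmEntry
      lcm-diagonal = congruence-diagonal inj (lcmPowerMatrix a x) (matrixBPow a x) _
        (λ k l → cong (λ g → + (g ℕ.^ a)) (lcm-comm (x k) (x l)))
        (λ k j k∤j → trans (matrixBPow≡matrixB* k j)
          (trans (cong (_* + ((x j ÷ x k) ℕ.^ a)) (matrixB-support k j k∤j)) (ℤ.*-zeroˡ (+ ((x j ÷ x k) ℕ.^ a)))))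
        (λ j → trans (matrixBPow≡matrixB* j j) (cong₂ (λ u v → u * + v) (matrixB-one j)
          (trans (cong (ℕ._^ a) (÷-unique 1 (x j) (x>0 j) (ℕ.*-identityˡ (x j)))) (ℕ.^-zeroˡ a))))
        (λ i k i∤k → trans (lcmSum i k) (columnSum-vanishes i i∤k λ r s w wrs≡x g≡ →
          cong (λ v → + (v ℕ.^ a)) (lcm-invariant i k r s w wrs≡x g≡)))
        -- The quotient of `x i` by `s` divides `x i`, so the lcm is `x i` and only the factor `s`
        -- varies.
        (λ i → trans (lcmSum i i) (alternatingSum-^ a (+ (x i ℕ.^ a)) (ys i) λ s s∣ →
          trans (cong (λ v → + (v ℕ.^ a)) (lcm-absorb i s (∣product⇒∣x i s∣)))
                (pos-^-* (x i) s a)))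
        where
        -- Multiplied by the common gcd, which is nonzero because `x k` is positive, both sides
        -- become x i * x k.
        lcm-invariant : ∀ i k r s w → w ℕ.* (r ℕ.* s) ≡ x i → gcd w (x k) ≡ gcd (w ℕ.* r) (x k) →
          r ℕ.* s ℕ.* lcm (x i ÷ (r ℕ.* s)) (x k) ≡ s ℕ.* lcm (x i ÷ s) (x k)
        lcm-invariant i k r s w wrs≡x g≡ = begin
          r ℕ.* s ℕ.* lcm (x i ÷ (r ℕ.* s)) (x k)  ≡⟨ cong (λ v → r ℕ.* s ℕ.* lcm v (x k)) (÷-unique w (r ℕ.* s) (x>0 i) wrs≡x) ⟩
          r ℕ.* s ℕ.* lcm w (x k)                  ≡⟨ ℕ.*-cancelˡ-≡ _ _ (gcd w (x k)) {{g≢0}} both ⟩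
          s ℕ.* lcm (w ℕ.* r) (x k)                ≡⟨ cong (λ v → s ℕ.* lcm v (x k)) (÷-unique (w ℕ.* r) s (x>0 i) wr*s≡x) ⟨
          s ℕ.* lcm (x i ÷ s) (x k)                ∎
          where
          open ≡-Reasoning
          wr*s≡x = trans (ℕ.*-assoc w r s) wrs≡x
          g≢0 : NonZero (gcd w (x k))
          g≢0 = ℕ.≢-nonZero (gcd[m,n]≢0 w (x k) (inj₂ (ℕ.m<n⇒n≢0 (x>0 k))))
          both : gcd w (x k) ℕ.* (r ℕ.* s ℕ.* lcm w (x k)) ≡ gcd w (x k) ℕ.* (s ℕ.* lcm (w ℕ.* r) (x k))
          both = begin
            gcd w (x k) ℕ.* (r ℕ.* s ℕ.* lcm w (x k))          ≡⟨ gcd*[m*lcm] (r ℕ.* s) w (x k) ⟩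
            w ℕ.* (r ℕ.* s) ℕ.* x k                            ≡⟨ cong (ℕ._* x k) (ℕ.*-assoc w r s) ⟨
            w ℕ.* r ℕ.* s ℕ.* x k                              ≡⟨ gcd*[m*lcm] s (w ℕ.* r) (x k) ⟨
            gcd (w ℕ.* r) (x k) ℕ.* (s ℕ.* lcm (w ℕ.* r) (x k)) ≡⟨ cong (ℕ._* (s ℕ.* lcm (w ℕ.* r) (x k))) g≡ ⟨
            gcd w (x k) ℕ.* (s ℕ.* lcm (w ℕ.* r) (x k))        ∎
        lcm-absorb : ∀ i s → s ∣ x i → s ℕ.* lcm (x i ÷ s) (x i) ≡ x i ℕ.* s
        lcm-absorb i s s∣x@(divides w x≡ws) = trans
          (cong (s ℕ.*_) (trans (cong (λ v → lcm v (x i)) (÷-unique w s (x>0 i) (sym x≡ws)))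
            (∣-antisym (lcm-least {w} {x i} (subst (w ∣_) (sym x≡ws) (m∣m*n s)) ∣-refl) (n∣lcm[m,n] w (x i)))))
          (ℕ.*-comm s (x i))

    -- Diagonal entries in the stated form.

    G-one : ∀ {i} → x i ≡ 1 → ys i ≡ []
    G-one {i} x≡1 with ys i in eq
    ... | []    = refl
    ... | y ∷ _ = contradiction (proj₁ (proj₂ (proj₂ (ys⇒ i y∈))))
        (λ y<x → ℕ.<⇒≱ (subst (y <_) x≡1 y<x) (S>0 (proj₁ (ys⇒ i y∈))))
      where
      y∈ : y ∈ ys i
      y∈ = subst (y ∈_) (sym eq) (here refl)

    -- Since 1 is a proper divisor of `x i` in `S`, some greatest-type divisor lies above it. So
    -- `ys i` is nonempty and the seed of the fold is immaterial.
    foldr-gcd≡gcds : ∀ {i} → 1 ∈ S → x i ≢ 1 → foldr gcd (x i) (ys i) ≡ gcds (ys i)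
    foldr-gcd≡gcds {i} 1∈S x≢1 with ∃-greatestTypeDivisor S>0 (x>0 i) 1∈S (1∣ x i) (x≢1 ∘ sym)
    ... | y , y∈ys , _ = nonempty (ys i) y∈ys (All.tabulate (proj₁ ∘ proj₂ ∘ ys⇒ i))
      where
      nonempty : ∀ zs → y ∈ zs → All (_∣ x i) zs → foldr gcd (x i) zs ≡ gcds zs
      nonempty (z ∷ zs) _ = foldr-gcd-nonempty z zs

  diag-cong : ∀ {d e : Vector ℤ n} → (∀ i → d i ≡ e i) → diag d ≈ₘ diag e
  diag-cong d≡e i j = cong (if does (i Fin.≟ j) then_else 0ℤ) (d≡e i)

open import Data.Vec.Functional using (_∷_)

theorem4p1 : ∀ (a : ℕ) .{{_ : NonZero a}} (m : ℕ) (x : Vector ℕ (suc m)) →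
    let S = tabulate x in
    (∀ i → 0 < x i) →
    Injective _≡_ _≡_ x →
    GcdClosed S →
    ConditionG S →
    gcds S ≡ 1 →
    x zero ≡ 1 →
    (transpose (matrixB x) · gcdPowerMatrix a x · matrixB x
    ≈ₘ diag (1ℤ ∷ λ i → let xᵢ = x (suc i) in
    + (gcds (G S xᵢ) ℕ.^ a) * ∏ (G S xᵢ) (λ y → + ((xᵢ ÷ y) ℕ.^ a) - 1ℤ)))
    ×
    (transpose (matrixBPow a x) · lcmPowerMatrix a x · matrixBPow a x
    ≈ₘ diag (1ℤ ∷ λ i → let xᵢ = x (suc i) in
    + (xᵢ ℕ.^ a) * ∏ (G S xᵢ) (λ y → 1ℤ - + ((xᵢ ÷ y) ℕ.^ a))))
theorem4p1 a m x x>0 inj closed condG _ x₀≡1 =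
  (λ i j → trans (gcd-diagonal a i j) (diag-cong gcd-entries i j)) ,
  (λ i j → trans (lcm-diagonal a i j) (diag-cong lcm-entries i j))
  where
  open GcdClosedSet x x>0 inj closed condG
  gcd-entries : ∀ i → gcdEntry a i ≡ (1ℤ ∷ λ i → let xᵢ = x (suc i) in
    + (gcds (G S xᵢ) ℕ.^ a) * ∏ (G S xᵢ) (λ y → + ((xᵢ ÷ y) ℕ.^ a) - 1ℤ)) i
  -- With no greatest-type divisors the fold returns its seed x zero = 1, where `gcds` would return
  -- 0.
  gcd-entries zero rewrite G-one x₀≡1 | x₀≡1 | ℕ.^-zeroˡ a = refl
  gcd-entries (suc i) =
    cong (λ g → + (g ℕ.^ a) * ∏ (ys (suc i)) (λ y → + ((x (suc i) ÷ y) ℕ.^ a) - 1ℤ))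
      (foldr-gcd≡gcds (subst (_∈ S) x₀≡1 (x∈S zero))
        (λ x≡1 → contradiction (inj (trans x≡1 (sym x₀≡1))) λ ()))
  lcm-entries : ∀ i → lcmEntry a i ≡ (1ℤ ∷ λ i → let xᵢ = x (suc i) in
    + (xᵢ ℕ.^ a) * ∏ (G S xᵢ) (λ y → 1ℤ - + ((xᵢ ÷ y) ℕ.^ a))) i
  lcm-entries zero rewrite G-one x₀≡1 | x₀≡1 | ℕ.^-zeroˡ a = refl
  lcm-entries (suc i) = refl
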